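{- Let $m=2\ell$ be an even positive integer, and let $C^{(m)}=(c_{ij})$ be the $m\times m$ coloring matrix with $c_{ij}=1$ if $i+j\le m+1$, except that $c_{ij}=0$ when $i+j=m$ and both $i,j$ are odd; and $c_{ij}=0$ if $i+j>m+1$. Then for every $n\ge1$, $$t_{C^{(m)}}(n)=\frac{\ell}{n}\cdot2^{2n-1}\binom{\frac{\ell+1}{2}n-\frac{\ell}{2}-1}{n-1}.$$
   Context: A plane tree is an unlabeled rooted tree in which the children of every vertex are linearly ordered. A coloring matrix is an $m\times m$ matrix $A=(a_{ij})$ with entries in $\{0,1\}$. An $A$-coloring of a plane tree assigns to each vertex a color in $\{1,\dots,m\}$ such that whenever a vertex of color $j$ is a child of a vertex of color $i$, $a_{ij}=1$. Let $t_A(n)$ be the number of pairs (plane tree with $n$ vertices, $A$-coloring of it). For real $y$ and integer $k\ge0$, $\binom{y}{k}=y(y-1)\cdots(y-k+1)/k!$. -}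

module Defs where

open import Data.Bool using (if_then_else_; _∧_; not)
open import Data.Fin using (Fin; toℕ)
open import Data.Fin.Patterns using (0F; 1F)
open import Data.Integer using (+_)
open import Data.List using (List; []; _∷_)
open import Data.List.Relation.Unary.All using (All)
open import Data.Nat using (ℕ; zero; suc; _+_; _!; _≤?_; _≟_; _%_)
open import Data.Nat.Properties using (_!≢0)
open import Data.Product using (Σ-syntax; ∃-syntax; _×_)
open import Data.Rational as ℚ using (ℚ)
open import Relation.Binary.PropositionalEquality using (_≡_)
open import Relation.Nullary.Decidable using (does)

data PlaneTree : Set where
  node : List PlaneTree → PlaneTree

mutual
  vertices : PlaneTree → ℕ
  vertices (node ts) = suc (verticesᶠ ts)

  verticesᶠ : List PlaneTree → ℕ
  verticesᶠ []       = 0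
  verticesᶠ (t ∷ ts) = vertices t + verticesᶠ ts

ColoringMatrix : ℕ → Set
ColoringMatrix m = Fin m → Fin m → Fin 2

-- A-colorings of a tree whose root has color i.  They are stored as trees of
-- colors rather than as functions on vertices, so that propositional equality
-- of colorings is equality at every vertex without function extensionality.
data RootedColoring {m} (A : ColoringMatrix m) (i : Fin m) : PlaneTree → Set where
  node : ∀ {ts} →
         All (λ t → ∃[ j ] (A i j ≡ 1F × RootedColoring A j t)) ts →
         RootedColoring A i (node ts)

Coloring : ∀ {m} → ColoringMatrix m → PlaneTree → Set
Coloring A t = ∃[ i ] RootedColoring A i t

ColoredTree : ∀ {m} → ColoringMatrix m → ℕ → Set
ColoredTree A n = Σ[ t ∈ PlaneTree ] (vertices t ≡ n × Coloring A t)

-- Row and column indices run over 1, …, m, so k : Fin m stands for suc (toℕ k).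
C⁽_⁾ : (m : ℕ) → ColoringMatrix m
C⁽ m ⁾ k l =
  let i = suc (toℕ k)
      j = suc (toℕ l)
      exceptional = does (i + j ≟ m) ∧ does (i % 2 ≟ 1) ∧ does (j % 2 ≟ 1)
  in if does (i + j ≤? m + 1) ∧ not exceptional then 1F else 0F

fromℕ : ℕ → ℚ
fromℕ k = + k ℚ./ 1

fallingFactorial : ℚ → ℕ → ℚ
fallingFactorial y zero    = ℚ.1ℚ
fallingFactorial y (suc k) = fallingFactorial y k ℚ.* (y ℚ.- fromℕ k)

binomial : ℚ → ℕ → ℚ
binomial y k = fallingFactorial y k ℚ.* (ℚ._/_ (+ 1) (k !) {{k !≢0}})

{-# OPTIONS --safe #-}
module Submission where

-- Let b = (ℓ + 1)/2 and let U k be the power series with coefficients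
-- 4ⁿ · a/(a + bn) · binom(a + bn, n) at a = −k/2.  The Rothe–Hagen identity says
-- U j · U k = U (j + k), and Pascal's rule gives U (ℓ − 1) − U (ℓ + 1) = 4x.
-- With colors counted from 0, the colors 2k and 2k + 1 both have the generating
-- function R k = (U k − U (k + 1))/2: in either row the sum over the allowed colors
-- telescopes to 1 − (U d + U (d + 1))/2, where d = ℓ − 1 − k, and
-- R k · (U d + U (d + 1))/2 = (U (ℓ − 1) − U (ℓ + 1))/4 = x.
-- Summing R over all colors telescopes to 1 − U ℓ.

open import Data.Bool using (true; false; if_then_else_; _∧_; not)
open import Data.Bool.Properties using (∧-zeroʳ)
open import Data.Empty using (⊥)
open import Data.Fin using (Fin; toℕ)
open import Data.Fin.Patterns using (0F; 1F)
open import Data.Fin.Properties using (+↔⊎; *↔×; 0↔⊥; 1↔⊤; toℕ<n)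
open import Data.Integer using (+_)
import Data.Integer as ℤ
import Data.Integer.Properties as ℤ
open import Data.List using (List; []; _∷_)
open import Data.List.Relation.Unary.All using (All; []; _∷_)
open import Data.Nat as ℕ using (ℕ; zero; suc; _∸_; _^_; _!; _%_; _≟_; _≤_; _<_; _≤?_; z≤n; s≤s; ⌊_/2⌋; NonZero)
open import Data.Nat.DivMod using ([m+kn]%n≡m%n)
import Data.Nat.Properties as ℕ
open import Data.Product using (Σ; Σ-syntax; ∃-syntax; _×_; _,_; proj₁; proj₂)
open import Data.Product.Function.NonDependent.Propositional using (_×-cong_)
open import Data.Rational using (ℚ; 0ℚ; 1ℚ; ½; _/_; _*_; _+_; _-_; -_; fromℚᵘ; toℚᵘ; +-*-rawSemiring)
open import Data.Rational.Properties using (toℚᵘ-injective; toℚᵘ-fromℚᵘ; toℚᵘ-homo-+; toℚᵘ-homo-*; fromℚᵘ-cong; +-0-monoid; +-comm; +-assoc; +-identityˡ; +-inverseʳ; *-comm; *-assoc; *-identityˡ; *-identityʳ)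
open import Data.Rational.Solver using (module +-*-Solver)
open import Data.Rational.Unnormalised as ℚᵘ using (mkℚᵘ; *≡*)
import Data.Rational.Unnormalised.Properties as ℚᵘ
open import Data.Sum using (_⊎_; inj₁; inj₂)
open import Data.Sum.Function.Propositional using (_⊎-cong_)
open import Data.Unit using (⊤; tt)
open import Function using (_∘_)
open import Function.Bundles using (_↔_; mk↔ₛ′)
open import Function.Construct.Composition using (_↔-∘_)
open import Relation.Binary.PropositionalEquality using (_≡_; _≢_; refl; sym; trans; cong; cong₂; subst; subst₂; module ≡-Reasoning)
open import Relation.Nullary using (¬_)
open import Relation.Nullary.Decidable using (does; dec-true; dec-false)
open import Algebra.Definitions.RawSemiring +-*-rawSemiring using () renaming (_^_ to _^ℚ_)
open import Algebra.Properties.Monoid.Sum +-0-monoid using (sum; sum-cong-≗)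
open import Defs
open +-*-Solver using (solve; con; _:=_; _:+_; _:*_; _:-_; :-_)

-- Let B be the generalized binomial series with B = 1 + 4x · B^b. Then `U k` is B^(-k/2), and
-- Pascal's rule is the functional equation B^a = B^(a-1) + 4x · B^(a+b-1) read coefficient by
-- coefficient. This forces b: at a = -(ℓ-1)/2 the last exponent vanishes exactly when b = (ℓ+1)/2,
-- and only the monomial 4x is left. The factor 4 compensates the two halves, one in R and one in
-- the average of U d and U (d + 1). Removing the root of a tree with root color i gives T_i = x /
-- (1 - S_i), where S_i is the sum of T_j over the colors j allowed below i. So the product of R k
-- with 1 minus its row sum being x is precisely the equation of the counting problem, and its
-- coefficient recursion is what the counting induction consumes.

-- Natural numbers, reciprocals and factorials in the rationals

fromℚᵘ-homo-+ : ∀ p q → fromℚᵘ (p ℚᵘ.+ q) ≡ fromℚᵘ p + fromℚᵘ q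
fromℚᵘ-homo-+ p q = toℚᵘ-injective (begin
  toℚᵘ (fromℚᵘ (p ℚᵘ.+ q))                  ≈⟨ toℚᵘ-fromℚᵘ (p ℚᵘ.+ q) ⟩
  p ℚᵘ.+ q                                  ≈⟨ ℚᵘ.+-cong (toℚᵘ-fromℚᵘ p) (toℚᵘ-fromℚᵘ q) ⟨
  toℚᵘ (fromℚᵘ p) ℚᵘ.+ toℚᵘ (fromℚᵘ q)      ≈⟨ toℚᵘ-homo-+ (fromℚᵘ p) (fromℚᵘ q) ⟨
  toℚᵘ (fromℚᵘ p + fromℚᵘ q)                ∎)
  where open ℚᵘ.≃-Reasoning

fromℚᵘ-homo-* : ∀ p q → fromℚᵘ (p ℚᵘ.* q) ≡ fromℚᵘ p * fromℚᵘ q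
fromℚᵘ-homo-* p q = toℚᵘ-injective (begin
  toℚᵘ (fromℚᵘ (p ℚᵘ.* q))                  ≈⟨ toℚᵘ-fromℚᵘ (p ℚᵘ.* q) ⟩
  p ℚᵘ.* q                                  ≈⟨ ℚᵘ.*-cong (toℚᵘ-fromℚᵘ p) (toℚᵘ-fromℚᵘ q) ⟨
  toℚᵘ (fromℚᵘ p) ℚᵘ.* toℚᵘ (fromℚᵘ q)      ≈⟨ toℚᵘ-homo-* (fromℚᵘ p) (fromℚᵘ q) ⟨
  toℚᵘ (fromℚᵘ p * fromℚᵘ q)                ∎)
  where open ℚᵘ.≃-Reasoning

open ≡-Reasoning

-- Normalization by the gcd is stuck on open terms, so the identity is checked on unnormalized
-- fractions with denominator 1 and carried over by `fromℚᵘ`.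
fromℕ-homo-+ : ∀ m n → fromℕ (m ℕ.+ n) ≡ fromℕ m + fromℕ n
fromℕ-homo-+ m n = trans
  (cong (λ i → fromℚᵘ (mkℚᵘ i 0)) (sym (cong₂ ℤ._+_ (ℤ.*-identityʳ (+ m)) (ℤ.*-identityʳ (+ n)))))
  (fromℚᵘ-homo-+ (mkℚᵘ (+ m) 0) (mkℚᵘ (+ n) 0))

fromℕ-homo-* : ∀ m n → fromℕ (m ℕ.* n) ≡ fromℕ m * fromℕ n
fromℕ-homo-* m n = trans
  (cong (λ i → fromℚᵘ (mkℚᵘ i 0)) (ℤ.pos-* m n))
  (fromℚᵘ-homo-* (mkℚᵘ (+ m) 0) (mkℚᵘ (+ n) 0))

fromℕ-suc : ∀ n → fromℕ (suc n) ≡ 1ℚ + fromℕ n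
fromℕ-suc = fromℕ-homo-+ 1

/-split : ∀ m d .{{_ : NonZero d}} → + m / d ≡ fromℕ m * (+ 1 / d)
/-split m (suc d) = trans
  (fromℚᵘ-cong {mkℚᵘ (+ m) d} {mkℚᵘ (+ m) 0 ℚᵘ.* mkℚᵘ (+ 1) d}
    (*≡* (cong₂ ℤ._*_ (sym (ℤ.*-identityʳ (+ m))) (cong (λ e → + suc e) (ℕ.+-identityʳ d)))))
  (fromℚᵘ-homo-* (mkℚᵘ (+ m) 0) (mkℚᵘ (+ 1) d))

fromℕ-*-1/ : ∀ d .{{_ : NonZero d}} → fromℕ d * (+ 1 / d) ≡ 1ℚ
fromℕ-*-1/ d@(suc d-1) = trans (sym (/-split d d))
  (fromℚᵘ-cong {mkℚᵘ (+ d) d-1} {mkℚᵘ (+ 1) 0} (*≡* (ℤ.*-comm (+ d) (+ 1))))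

fromℕ-suc-*-cancelˡ : ∀ n {p q} → fromℕ (suc n) * p ≡ fromℕ (suc n) * q → p ≡ q
fromℕ-suc-*-cancelˡ n {p} {q} eq = trans (sym (unscale p)) (trans (cong ((+ 1 / suc n) *_) eq) (unscale q))
  where
  unscale : ∀ r → (+ 1 / suc n) * (fromℕ (suc n) * r) ≡ r
  unscale r = begin
    (+ 1 / suc n) * (fromℕ (suc n) * r) ≡⟨ *-assoc (+ 1 / suc n) (fromℕ (suc n)) r ⟨
    (+ 1 / suc n) * fromℕ (suc n) * r   ≡⟨ cong (_* r) (*-comm (+ 1 / suc n) (fromℕ (suc n))) ⟩
    fromℕ (suc n) * (+ 1 / suc n) * r   ≡⟨ cong (_* r) (fromℕ-*-1/ (suc n)) ⟩
    1ℚ * r                              ≡⟨ *-identityˡ r ⟩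
    r                                   ∎

1/! : ℕ → ℚ
1/! n = (+ 1 / (n !)) {{n ℕ.!≢0}}

1/!-suc : ∀ n → fromℕ (suc n) * 1/! (suc n) ≡ 1/! n
1/!-suc n = begin
  s * i                    ≡⟨ *-identityʳ (s * i) ⟨
  s * i * 1ℚ               ≡⟨ cong (s * i *_) (fromℕ-*-1/ (n !) {{n ℕ.!≢0}}) ⟨
  s * i * (f * j)          ≡⟨ solve 4 (λ s i f j → s :* i :* (f :* j) := s :* f :* i :* j) refl s i f j ⟩
  s * f * i * j            ≡⟨ cong (λ r → r * i * j) (fromℕ-homo-* (suc n) (n !)) ⟨
  fromℕ (suc n !) * i * j  ≡⟨ cong (_* j) (fromℕ-*-1/ (suc n !) {{suc n ℕ.!≢0}}) ⟩
  1ℚ * j                   ≡⟨ *-identityˡ j ⟩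
  j                        ∎
  where
  s = fromℕ (suc n)
  f = fromℕ (n !)
  i = 1/! (suc n)
  j = 1/! n

-- The definition splits off the last factor. Pascal's rule compares arguments y and y - 1, for
-- which the first factor must be split off.
fallingFactorial-suc : ∀ y k → fallingFactorial y (suc k) ≡ y * fallingFactorial (y - 1ℚ) k
fallingFactorial-suc y zero = solve 1 (λ y → con 1ℚ :* (y :- con 0ℚ) := y :* con 1ℚ) refl y
fallingFactorial-suc y (suc k) = begin
  fallingFactorial y (suc k) * (y - fromℕ (suc k))
    ≡⟨ cong₂ (λ p q → p * (y - q)) (fallingFactorial-suc y k) (fromℕ-suc k) ⟩
  y * fallingFactorial (y - 1ℚ) k * (y - (1ℚ + fromℕ k))
    ≡⟨ solve 3 (λ y f k → y :* f :* (y :- (con 1ℚ :+ k)) := y :* (f :* (y :- con 1ℚ :- k))) refl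
         y (fallingFactorial (y - 1ℚ) k) (fromℕ k) ⟩
  y * fallingFactorial (y - 1ℚ) (suc k) ∎

-- Convolution

infixl 8 _⊛_

-- The Cauchy product, by recursion on f = f 0 + x · (f ∘ suc). This avoids indices n ∸ p and has
-- the same shape as splitting a forest size in `Split-suc`.
_⊛_ : (ℕ → ℚ) → (ℕ → ℚ) → ℕ → ℚ
(f ⊛ g) zero    = f 0 * g 0
(f ⊛ g) (suc n) = f 0 * g (suc n) + (f ∘ suc ⊛ g) n

⊛-congˡ : ∀ {f f′} g n → (∀ p → f p ≡ f′ p) → (f ⊛ g) n ≡ (f′ ⊛ g) n
⊛-congˡ g zero    eq = cong (_* g 0) (eq 0)
⊛-congˡ g (suc n) eq = cong₂ _+_ (cong (_* g (suc n)) (eq 0)) (⊛-congˡ g n (eq ∘ suc))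

⊛-sucʳ : ∀ f g n → (f ⊛ g) (suc n) ≡ (f ⊛ g ∘ suc) n + f (suc n) * g 0
⊛-sucʳ f g zero    = refl
⊛-sucʳ f g (suc n) = begin
  a + (f ∘ suc ⊛ g) (suc n)                   ≡⟨ cong (λ r → a + r) (⊛-sucʳ (f ∘ suc) g n) ⟩
  a + ((f ∘ suc ⊛ g ∘ suc) n + b)             ≡⟨ solve 3 (λ a c b → a :+ (c :+ b) := a :+ c :+ b) refl
                                                   a ((f ∘ suc ⊛ g ∘ suc) n) b ⟩
  a + (f ∘ suc ⊛ g ∘ suc) n + b               ∎
  where
  a = f 0 * g (suc (suc n))
  b = f (suc (suc n)) * g 0

⊛-comm : ∀ f g n → (f ⊛ g) n ≡ (g ⊛ f) n
⊛-comm f g zero    = *-comm (f 0) (g 0)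
⊛-comm f g (suc n) = begin
  f 0 * g (suc n) + (f ∘ suc ⊛ g) n   ≡⟨ cong₂ _+_ (*-comm (f 0) (g (suc n))) (⊛-comm (f ∘ suc) g n) ⟩
  g (suc n) * f 0 + (g ⊛ f ∘ suc) n   ≡⟨ +-comm (g (suc n) * f 0) _ ⟩
  (g ⊛ f ∘ suc) n + g (suc n) * f 0   ≡⟨ ⊛-sucʳ g f n ⟨
  (g ⊛ f) (suc n)                     ∎

⊛-linearˡ : ∀ c d f g h n →
            ((λ p → c * f p + d * g p) ⊛ h) n ≡ c * (f ⊛ h) n + d * (g ⊛ h) n
⊛-linearˡ c d f g h zero =
  solve 5 (λ c d x y z → (c :* x :+ d :* y) :* z := c :* (x :* z) :+ d :* (y :* z)) refl
    c d (f 0) (g 0) (h 0)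
⊛-linearˡ c d f g h (suc n) = begin
  (c * f 0 + d * g 0) * h (suc n) + ((λ p → c * f (suc p) + d * g (suc p)) ⊛ h) n
    ≡⟨ cong (λ r → (c * f 0 + d * g 0) * h (suc n) + r) (⊛-linearˡ c d (f ∘ suc) (g ∘ suc) h n) ⟩
  (c * f 0 + d * g 0) * h (suc n) + (c * (f ∘ suc ⊛ h) n + d * (g ∘ suc ⊛ h) n)
    ≡⟨ solve 7 (λ c d x y z u v → (c :* x :+ d :* y) :* z :+ (c :* u :+ d :* v)
                 := c :* (x :* z :+ u) :+ d :* (y :* z :+ v)) refl
         c d (f 0) (g 0) (h (suc n)) ((f ∘ suc ⊛ h) n) ((g ∘ suc ⊛ h) n) ⟩
  c * (f ⊛ h) (suc n) + d * (g ⊛ h) (suc n) ∎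

θ : (ℕ → ℚ) → ℕ → ℚ
θ f n = fromℕ n * f n

-- The product rule for the Euler operator x d/dx. In both summands the differentiated series stands
-- on the left, where `θF-⊛` can rewrite it.
⊛-leibniz : ∀ f g n → fromℕ n * (f ⊛ g) n ≡ (θ f ⊛ g) n + (θ g ⊛ f) n
⊛-leibniz f g zero = solve 2 (λ x y → con 0ℚ :* (x :* y) := con 0ℚ :* x :* y :+ con 0ℚ :* y :* x) refl (f 0) (g 0)
⊛-leibniz f g (suc n) = begin
  fromℕ (suc n) * (x * y + c)
    ≡⟨ solve 4 (λ s x y c → s :* (x :* y :+ c) := x :* (s :* y) :+ s :* c) refl (fromℕ (suc n)) x y c ⟩
  x * θ g (suc n) + fromℕ (suc n) * c
    ≡⟨ cong (λ s → x * θ g (suc n) + s * c) (fromℕ-suc n) ⟩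
  x * θ g (suc n) + (1ℚ + fromℕ n) * c
    ≡⟨ solve 3 (λ a n c → a :+ (con 1ℚ :+ n) :* c := a :+ (c :+ n :* c)) refl (x * θ g (suc n)) (fromℕ n) c ⟩
  x * θ g (suc n) + (c + fromℕ n * c)
    ≡⟨ cong (λ r → x * θ g (suc n) + (c + r)) (⊛-leibniz (f ∘ suc) g n) ⟩
  x * θ g (suc n) + (c + (d + (θ g ⊛ f ∘ suc) n))
    ≡⟨ solve 6 (λ x y a c d e → a :+ (c :+ (d :+ e)) := con 0ℚ :* x :* y :+ (con 1ℚ :* c :+ con 1ℚ :* d) :+ (e :+ a)) refl
         x y (x * θ g (suc n)) c d ((θ g ⊛ f ∘ suc) n) ⟩
  0ℚ * x * y + (1ℚ * c + 1ℚ * d) + ((θ g ⊛ f ∘ suc) n + x * θ g (suc n))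
    ≡⟨ cong₂ (λ p q → 0ℚ * x * y + p + ((θ g ⊛ f ∘ suc) n + q)) θ-suc (*-comm x (θ g (suc n))) ⟩
  0ℚ * x * y + (θ f ∘ suc ⊛ g) n + ((θ g ⊛ f ∘ suc) n + θ g (suc n) * x)
    ≡⟨ cong (λ r → 0ℚ * x * y + (θ f ∘ suc ⊛ g) n + r) (⊛-sucʳ (θ g) f n) ⟨
  (θ f ⊛ g) (suc n) + (θ g ⊛ f) (suc n) ∎
  where
  x = f 0
  y = g (suc n)
  c = (f ∘ suc ⊛ g) n
  d = (θ (f ∘ suc) ⊛ g) n

  -- Shifting does not commute with θ: the coefficient p + 1 contributes one extra copy of
  -- `f ∘ suc`.
  θ-suc : 1ℚ * c + 1ℚ * d ≡ (θ f ∘ suc ⊛ g) n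
  θ-suc = trans (sym (⊛-linearˡ 1ℚ 1ℚ (f ∘ suc) (θ (f ∘ suc)) g n))
    (⊛-congˡ g n λ p → begin
      1ℚ * f (suc p) + 1ℚ * (fromℕ p * f (suc p))
        ≡⟨ solve 2 (λ p x → con 1ℚ :* x :+ con 1ℚ :* (p :* x) := (con 1ℚ :+ p) :* x) refl (fromℕ p) (f (suc p)) ⟩
      (1ℚ + fromℕ p) * f (suc p)  ≡⟨ cong (_* f (suc p)) (fromℕ-suc p) ⟨
      fromℕ (suc p) * f (suc p)   ∎)

-- The hypotheses say f = f′ + z x h as power series; multiply by g.
⊛-shift-difference : ∀ z f f′ h g n → f 0 ≡ f′ 0 → (∀ p → f (suc p) ≡ f′ (suc p) + z * h p) →
                     (f ⊛ g) (suc n) ≡ (f′ ⊛ g) (suc n) + z * (h ⊛ g) n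
⊛-shift-difference z f f′ h g n eq₀ eq = begin
  f 0 * g (suc n) + (f ∘ suc ⊛ g) n
    ≡⟨ cong₂ _+_ (cong (_* g (suc n)) eq₀) (⊛-congˡ g n λ p → trans (eq p) (cong (_+ z * h p) (sym (*-identityˡ (f′ (suc p)))))) ⟩
  f′ 0 * g (suc n) + ((λ p → 1ℚ * f′ (suc p) + z * h p) ⊛ g) n
    ≡⟨ cong (λ r → f′ 0 * g (suc n) + r) (⊛-linearˡ 1ℚ z (f′ ∘ suc) h g n) ⟩
  f′ 0 * g (suc n) + (1ℚ * (f′ ∘ suc ⊛ g) n + z * (h ⊛ g) n)
    ≡⟨ solve 3 (λ a b c → a :+ (con 1ℚ :* b :+ c) := a :+ b :+ c) refl
         (f′ 0 * g (suc n)) ((f′ ∘ suc ⊛ g) n) (z * (h ⊛ g) n) ⟩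
  (f′ ⊛ g) (suc n) + z * (h ⊛ g) n ∎

-- The Rothe–Hagen identity

module Rothe (b z : ℚ) where

  top : ℚ → ℕ → ℚ
  top a n = a + b * fromℕ n - 1ℚ

  -- F a n = zⁿ · a/(a + bn) · binom(a + bn, n), and G a n = n · F a n / a, written
  -- without the denominators a + bn and a, which may vanish.
  F : ℚ → ℕ → ℚ
  F a zero    = 1ℚ
  F a (suc n) = z ^ℚ suc n * (a * (fallingFactorial (top a (suc n)) n * 1/! (suc n)))

  G : ℚ → ℕ → ℚ
  G a zero    = 0ℚ
  G a (suc n) = z ^ℚ suc n * (fallingFactorial (top a (suc n)) n * 1/! n)

  θF : ∀ a n → θ (F a) n ≡ a * G a n
  θF a zero    = solve 1 (λ a → con 0ℚ :* con 1ℚ := a :* con 0ℚ) refl a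
  θF a (suc n) = begin
    s * (z ^ℚ suc n * (a * (f * 1/! (suc n))))
      ≡⟨ solve 5 (λ s z a f i → s :* (z :* (a :* (f :* i))) := a :* (z :* (f :* (s :* i)))) refl
           s (z ^ℚ suc n) a f (1/! (suc n)) ⟩
    a * (z ^ℚ suc n * (f * (s * 1/! (suc n))))
      ≡⟨ cong (λ i → a * (z ^ℚ suc n * (f * i))) (1/!-suc n) ⟩
    a * G a (suc n) ∎
    where
    s = fromℕ (suc n)
    f = fallingFactorial (top a (suc n)) n

  top-pred : ∀ a n → top (a - 1ℚ) n ≡ top a n - 1ℚ
  top-pred a n = solve 2 (λ a x → a :- con 1ℚ :+ x :- con 1ℚ := a :+ x :- con 1ℚ :- con 1ℚ) refl a (b * fromℕ n)

  top-shift : ∀ a n → top (a + b - 1ℚ) n ≡ top a (suc n) - 1ℚ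
  top-shift a n = begin
    a + b - 1ℚ + b * fromℕ n - 1ℚ
      ≡⟨ solve 3 (λ a b n → a :+ b :- con 1ℚ :+ b :* n :- con 1ℚ := a :+ b :* (con 1ℚ :+ n) :- con 1ℚ :- con 1ℚ) refl
           a b (fromℕ n) ⟩
    a + b * (1ℚ + fromℕ n) - 1ℚ - 1ℚ
      ≡⟨ cong (λ s → a + b * s - 1ℚ - 1ℚ) (fromℕ-suc n) ⟨
    top a (suc n) - 1ℚ ∎

  -- With the common factor z^(n+1) · `f` · `i` pulled out, writing s for the index on the left and
  -- y = a + bs - 1, what remains is a·y = (a - 1)(y + 1 - s) + (a + b - 1)·s. The index 1 is
  -- separate because `f` has one factor fewer than the falling factorial on the left.
  F-pascal : ∀ a n → F a (suc n) ≡ F (a - 1ℚ) (suc n) + z * F (a + b - 1ℚ) n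
  F-pascal a zero = solve 2 (λ a z → z :* con 1ℚ :* (a :* (con 1ℚ :* con 1ℚ))
      := z :* con 1ℚ :* ((a :- con 1ℚ) :* (con 1ℚ :* con 1ℚ)) :+ z :* con 1ℚ) refl a z
  F-pascal a (suc m) = begin
    z ^ℚ suc n * (a * (fallingFactorial y n * i))
      ≡⟨ cong (λ f → z ^ℚ suc n * (a * (f * i))) (fallingFactorial-suc y m) ⟩
    z ^ℚ suc n * (a * (y * f * i))
      ≡⟨ step (z ^ℚ suc n) (fromℕ m) f i (trans (fromℕ-suc n) (cong (λ r → 1ℚ + r) (fromℕ-suc m))) ⟩
    z ^ℚ suc n * ((a - 1ℚ) * (fallingFactorial (y - 1ℚ) n * i))
      + z * z ^ℚ n * ((a + b - 1ℚ) * (f * (fromℕ (suc n) * i)))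
      ≡⟨ cong₂ (λ x j → z ^ℚ suc n * ((a - 1ℚ) * (fallingFactorial x n * i)) + z * z ^ℚ n * ((a + b - 1ℚ) * (f * j)))
           (sym (top-pred a (suc n))) (1/!-suc n) ⟩
    F (a - 1ℚ) (suc n) + z * z ^ℚ n * ((a + b - 1ℚ) * (f * 1/! n))
      ≡⟨ cong (λ r → F (a - 1ℚ) (suc n) + r) (*-assoc z (z ^ℚ n) ((a + b - 1ℚ) * (f * 1/! n))) ⟩
    F (a - 1ℚ) (suc n) + z * (z ^ℚ n * ((a + b - 1ℚ) * (f * 1/! n)))
      ≡⟨ cong (λ x → F (a - 1ℚ) (suc n) + z * (z ^ℚ n * ((a + b - 1ℚ) * (fallingFactorial x m * 1/! n)))) (top-shift a n) ⟨
    F (a - 1ℚ) (suc n) + z * F (a + b - 1ℚ) n ∎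
    where
    n = suc m
    y = top a (suc n)
    f = fallingFactorial (y - 1ℚ) m
    i = 1/! (suc n)

    step : ∀ Z m f i {s} → s ≡ 1ℚ + (1ℚ + m) →
           let y = a + b * s - 1ℚ in
           Z * (a * (y * f * i)) ≡
           Z * ((a - 1ℚ) * (f * (y - 1ℚ - m) * i)) + Z * ((a + b - 1ℚ) * (f * (s * i)))
    step Z m f i refl = solve 6 (λ Z a b m f i →
      let S = con 1ℚ :+ (con 1ℚ :+ m)
          Y = a :+ b :* S :- con 1ℚ
      in Z :* (a :* (Y :* f :* i)) :=
         Z :* ((a :- con 1ℚ) :* (f :* (Y :- con 1ℚ :- m) :* i)) :+ Z :* ((a :+ b :- con 1ℚ) :* (f :* (S :* i))))
      refl Z a b m f i

  -- Since G a (n + 1) = z^(n+1) · binom(a + b(n + 1) - 1, n), this is the ordinary Pascal rule for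
  -- binomial coefficients.
  G-pascal : ∀ a n → G a (suc n) ≡ G (a - 1ℚ) (suc n) + z * G (a + b - 1ℚ) n
  G-pascal a zero = solve 1 (λ z → z :* con 1ℚ :* (con 1ℚ :* con 1ℚ)
      := z :* con 1ℚ :* (con 1ℚ :* con 1ℚ) :+ z :* con 0ℚ) refl z
  G-pascal a (suc m) = begin
    z ^ℚ suc n * (fallingFactorial y n * i)
      ≡⟨ cong (λ f → z ^ℚ suc n * (f * i)) (fallingFactorial-suc y m) ⟩
    z ^ℚ suc n * (y * f * i)
      ≡⟨ solve 5 (λ Z y m f i → Z :* (y :* f :* i) :=
           Z :* (f :* (y :- con 1ℚ :- m) :* i) :+ Z :* (f :* ((con 1ℚ :+ m) :* i))) refl
           (z ^ℚ suc n) y (fromℕ m) f i ⟩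
    z ^ℚ suc n * (fallingFactorial (y - 1ℚ) n * i) + z ^ℚ suc n * (f * ((1ℚ + fromℕ m) * i))
      ≡⟨ cong₂ (λ x j → z ^ℚ suc n * (fallingFactorial x n * i) + z ^ℚ suc n * (f * j))
           (sym (top-pred a (suc n))) (trans (cong (_* i) (sym (fromℕ-suc m))) (1/!-suc m)) ⟩
    G (a - 1ℚ) (suc n) + z * z ^ℚ n * (f * 1/! m)
      ≡⟨ cong (λ r → G (a - 1ℚ) (suc n) + r) (*-assoc z (z ^ℚ n) (f * 1/! m)) ⟩
    G (a - 1ℚ) (suc n) + z * (z ^ℚ n * (f * 1/! m))
      ≡⟨ cong (λ x → G (a - 1ℚ) (suc n) + z * (z ^ℚ n * (fallingFactorial x m * 1/! m))) (top-shift a n) ⟨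
    G (a - 1ℚ) (suc n) + z * G (a + b - 1ℚ) n ∎
    where
    n = suc m
    y = top a (suc n)
    f = fallingFactorial (y - 1ℚ) m
    i = 1/! n

  F-⊛-predˡ : ∀ a g n → (F a ⊛ g) (suc n) ≡ (F (a - 1ℚ) ⊛ g) (suc n) + z * (F (a + b - 1ℚ) ⊛ g) n
  F-⊛-predˡ a g n = ⊛-shift-difference z (F a) (F (a - 1ℚ)) (F (a + b - 1ℚ)) g n refl (F-pascal a)

  G-⊛-predˡ : ∀ a g n → (G a ⊛ g) (suc n) ≡ (G (a - 1ℚ) ⊛ g) (suc n) + z * (G (a + b - 1ℚ) ⊛ g) n
  G-⊛-predˡ a g n = ⊛-shift-difference z (G a) (G (a - 1ℚ)) (G (a + b - 1ℚ)) g n refl (G-pascal a)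

  F-⊛-predʳ : ∀ a g n → (g ⊛ F a) (suc n) ≡ (g ⊛ F (a - 1ℚ)) (suc n) + z * (g ⊛ F (a + b - 1ℚ)) n
  F-⊛-predʳ a g n = begin
    (g ⊛ F a) (suc n)  ≡⟨ ⊛-comm g (F a) (suc n) ⟩
    (F a ⊛ g) (suc n)  ≡⟨ F-⊛-predˡ a g n ⟩
    (F (a - 1ℚ) ⊛ g) (suc n) + z * (F (a + b - 1ℚ) ⊛ g) n
      ≡⟨ cong₂ (λ p q → p + z * q) (⊛-comm (F (a - 1ℚ)) g (suc n)) (⊛-comm (F (a + b - 1ℚ)) g n) ⟩
    (g ⊛ F (a - 1ℚ)) (suc n) + z * (g ⊛ F (a + b - 1ℚ)) n ∎

  θF-⊛ : ∀ a g n → (θ (F a) ⊛ g) n ≡ a * (G a ⊛ g) n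
  θF-⊛ a g n = begin
    (θ (F a) ⊛ g) n                          ≡⟨ ⊛-congˡ g n (λ p → trans (θF a p) (pad (G a p))) ⟩
    ((λ p → a * G a p + 0ℚ * G a p) ⊛ g) n   ≡⟨ ⊛-linearˡ a 0ℚ (G a) (G a) g n ⟩
    a * (G a ⊛ g) n + 0ℚ * (G a ⊛ g) n       ≡⟨ pad ((G a ⊛ g) n) ⟨
    a * (G a ⊛ g) n                          ∎
    where
    -- A dummy second summand with coefficient 0 turns `⊛-linearˡ` into the rule for scalar
    -- multiples.
    pad : ∀ x → a * x ≡ a * x + 0ℚ * x
    pad x = solve 2 (λ a x → a :* x := a :* x :+ con 0ℚ :* x) refl a x

  -- The defects δ and γ of the two convolution identities at n + 1 have period 1
  -- in both arguments, because of the Pascal rules and the identities at n.  As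
  -- (n + 1) δ a c = a γ a c + c γ c a, replacing a by a − 1 shows γ a c = 0, and
  -- then δ a c = 0.
  rothe-hagen : ∀ n a c → ((F a ⊛ F c) n ≡ F (a + c) n) × ((G a ⊛ F c) n ≡ G (a + c) n)
  rothe-hagen zero    a c = refl , refl
  rothe-hagen (suc n) a c = F-identity , x-y≡0⇒x≡y (γ≡0 a c)
    where
    x-y≡0⇒x≡y : ∀ {x y} → x - y ≡ 0ℚ → x ≡ y
    x-y≡0⇒x≡y {x} {y} eq = begin
      x           ≡⟨ solve 2 (λ x y → x := x :- y :+ y) refl x y ⟩
      x - y + y   ≡⟨ cong (_+ y) eq ⟩
      0ℚ + y      ≡⟨ +-identityˡ y ⟩
      y           ∎

    δ γ : ℚ → ℚ → ℚ
    δ a c = (F a ⊛ F c) (suc n) - F (a + c) (suc n)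
    γ a c = (G a ⊛ F c) (suc n) - G (a + c) (suc n)

    slideˡ : ∀ a c → a + c - 1ℚ ≡ a - 1ℚ + c
    slideˡ a c = solve 2 (λ a c → a :+ c :- con 1ℚ := a :- con 1ℚ :+ c) refl a c

    slideʳ : ∀ a c → a + c - 1ℚ ≡ a + (c - 1ℚ)
    slideʳ a c = solve 2 (λ a c → a :+ c :- con 1ℚ := a :+ (c :- con 1ℚ)) refl a c

    shiftˡ : ∀ a c → a + b - 1ℚ + c ≡ a + c + b - 1ℚ
    shiftˡ a c = solve 3 (λ a b c → a :+ b :- con 1ℚ :+ c := a :+ c :+ b :- con 1ℚ) refl a b c

    shiftʳ : ∀ a c → a + (c + b - 1ℚ) ≡ a + c + b - 1ℚ
    shiftʳ a c = solve 3 (λ a b c → a :+ (c :+ b :- con 1ℚ) := a :+ c :+ b :- con 1ℚ) refl a b c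

    cancel : ∀ x′ y′ {u u′ x y} → x ≡ x′ + z * u → y ≡ y′ + z * u′ → u ≡ u′ → x - y ≡ x′ - y′
    cancel x′ y′ {u} refl refl refl =
      solve 3 (λ x′ y′ w → x′ :+ w :- (y′ :+ w) := x′ :- y′) refl x′ y′ (z * u)

    δ-pred : ∀ a c → δ a c ≡ δ (a - 1ℚ) c
    δ-pred a c = trans
      (cancel ((F (a - 1ℚ) ⊛ F c) (suc n)) (F (a + c - 1ℚ) (suc n)) (F-⊛-predˡ a (F c) n) (F-pascal (a + c) n)
        (trans (proj₁ (rothe-hagen n (a + b - 1ℚ) c)) (cong (λ r → F r n) (shiftˡ a c))))
      (cong (λ r → (F (a - 1ℚ) ⊛ F c) (suc n) - F r (suc n)) (slideˡ a c))

    γ-predˡ : ∀ a c → γ a c ≡ γ (a - 1ℚ) c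
    γ-predˡ a c = trans
      (cancel ((G (a - 1ℚ) ⊛ F c) (suc n)) (G (a + c - 1ℚ) (suc n)) (G-⊛-predˡ a (F c) n) (G-pascal (a + c) n)
        (trans (proj₂ (rothe-hagen n (a + b - 1ℚ) c)) (cong (λ r → G r n) (shiftˡ a c))))
      (cong (λ r → (G (a - 1ℚ) ⊛ F c) (suc n) - G r (suc n)) (slideˡ a c))

    γ-predʳ : ∀ a c → γ a c ≡ γ a (c - 1ℚ)
    γ-predʳ a c = trans
      (cancel ((G a ⊛ F (c - 1ℚ)) (suc n)) (G (a + c - 1ℚ) (suc n)) (F-⊛-predʳ c (G a) n) (G-pascal (a + c) n)
        (trans (proj₂ (rothe-hagen n a (c + b - 1ℚ))) (cong (λ r → G r n) (shiftʳ a c))))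
      (cong (λ r → (G a ⊛ F (c - 1ℚ)) (suc n) - G r (suc n)) (slideʳ a c))

    δ-γ : ∀ a c → fromℕ (suc n) * δ a c ≡ a * γ a c + c * γ c a
    δ-γ a c = begin
      s * (C - F (a + c) (suc n))
        ≡⟨ solve 3 (λ s x y → s :* (x :- y) := s :* x :- s :* y) refl s C (F (a + c) (suc n)) ⟩
      s * C - s * F (a + c) (suc n)
        ≡⟨ cong₂ _-_ (⊛-leibniz (F a) (F c) (suc n)) (θF (a + c) (suc n)) ⟩
      (θ (F a) ⊛ F c) (suc n) + (θ (F c) ⊛ F a) (suc n) - (a + c) * g
        ≡⟨ cong₂ (λ p q → p + q - (a + c) * g) (θF-⊛ a (F c) (suc n)) (θF-⊛ c (F a) (suc n)) ⟩
      a * D + c * E - (a + c) * g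
        ≡⟨ solve 5 (λ a c D E g → a :* D :+ c :* E :- (a :+ c) :* g := a :* (D :- g) :+ c :* (E :- g)) refl a c D E g ⟩
      a * (D - g) + c * (E - g)
        ≡⟨ cong (λ r → a * (D - g) + c * (E - G r (suc n))) (+-comm a c) ⟩
      a * γ a c + c * γ c a ∎
      where
      s = fromℕ (suc n)
      C = (F a ⊛ F c) (suc n)
      D = (G a ⊛ F c) (suc n)
      E = (G c ⊛ F a) (suc n)
      g = G (a + c) (suc n)

    γ≡0 : ∀ a c → γ a c ≡ 0ℚ
    γ≡0 a c = begin
      γ a c
        ≡⟨ solve 4 (λ a c x y → x := a :* x :+ c :* y :- ((a :- con 1ℚ) :* x :+ c :* y)) refl a c (γ a c) (γ c a) ⟩
      a * γ a c + c * γ c a - ((a - 1ℚ) * γ a c + c * γ c a)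
        ≡⟨ cong₂ (λ p q → a * γ a c + c * γ c a - ((a - 1ℚ) * p + c * q)) (γ-predˡ a c) (γ-predʳ c a) ⟩
      a * γ a c + c * γ c a - ((a - 1ℚ) * γ (a - 1ℚ) c + c * γ c (a - 1ℚ))
        ≡⟨ cong₂ _-_ (δ-γ a c) (δ-γ (a - 1ℚ) c) ⟨
      s * δ a c - s * δ (a - 1ℚ) c
        ≡⟨ cong (λ r → s * δ a c - s * r) (δ-pred a c) ⟨
      s * δ a c - s * δ a c
        ≡⟨ solve 1 (λ x → x :- x := con 0ℚ) refl (s * δ a c) ⟩
      0ℚ ∎
      where s = fromℕ (suc n)

    F-identity : (F a ⊛ F c) (suc n) ≡ F (a + c) (suc n)
    F-identity = x-y≡0⇒x≡y (fromℕ-suc-*-cancelˡ n (begin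
      fromℕ (suc n) * δ a c   ≡⟨ δ-γ a c ⟩
      a * γ a c + c * γ c a   ≡⟨ cong₂ (λ p q → a * p + c * q) (γ≡0 a c) (γ≡0 c a) ⟩
      a * 0ℚ + c * 0ℚ         ≡⟨ solve 3 (λ a c s → a :* con 0ℚ :+ c :* con 0ℚ := s :* con 0ℚ) refl a c (fromℕ (suc n)) ⟩
      fromℕ (suc n) * 0ℚ      ∎))

  F-⊛ : ∀ a c n → (F a ⊛ F c) n ≡ F (a + c) n
  F-⊛ a c n = proj₁ (rothe-hagen n a c)

-- Counting colored trees

-- The cardinality is recorded as a rational so that coefficients of the series can be used as they
-- are. That they are natural numbers comes out of the count.
HasCount : Set → ℚ → Set
HasCount X q = ∃[ t ] ((Fin t ↔ X) × fromℕ t ≡ q)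

module _ {X Y : Set} where

  count-↔ : ∀ {q} → X ↔ Y → HasCount X q → HasCount Y q
  count-↔ X↔Y (t , Fin↔X , eq) = t , X↔Y ↔-∘ Fin↔X , eq

  count-⊎ : ∀ {q r} → HasCount X q → HasCount Y r → HasCount (X ⊎ Y) (q + r)
  count-⊎ (s , Fin↔X , refl) (t , Fin↔Y , refl) =
    s ℕ.+ t , (Fin↔X ⊎-cong Fin↔Y) ↔-∘ +↔⊎ , fromℕ-homo-+ s t

  count-× : ∀ {q r} → HasCount X q → HasCount Y r → HasCount (X × Y) (q * r)
  count-× (s , Fin↔X , refl) (t , Fin↔Y , refl) =
    s ℕ.* t , (Fin↔X ×-cong Fin↔Y) ↔-∘ *↔× , fromℕ-homo-* s t

Σ-Fin-zero : ∀ {X : Fin 0 → Set} → ⊥ ↔ Σ (Fin 0) X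
Σ-Fin-zero = mk↔ₛ′ (λ ()) (λ ()) (λ ()) (λ ())

Σ-Fin-suc : ∀ {m} {X : Fin (suc m) → Set} → (X Fin.zero ⊎ Σ (Fin m) (X ∘ Fin.suc)) ↔ Σ (Fin (suc m)) X
Σ-Fin-suc = mk↔ₛ′
  (λ { (inj₁ x) → Fin.zero , x ; (inj₂ (i , x)) → Fin.suc i , x })
  (λ { (Fin.zero , x) → inj₁ x ; (Fin.suc i , x) → inj₂ (i , x) })
  (λ { (Fin.zero , x) → refl ; (Fin.suc i , x) → refl })
  (λ { (inj₁ x) → refl ; (inj₂ (i , x)) → refl })

count-Σ : ∀ {m} {X : Fin m → Set} {q} → (∀ i → HasCount (X i) (q i)) → HasCount (Σ (Fin m) X) (sum q)
count-Σ {zero}  c = 0 , Σ-Fin-zero ↔-∘ 0↔⊥ , refl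
count-Σ {suc m} c = count-↔ Σ-Fin-suc (count-⊎ (c Fin.zero) (count-Σ (c ∘ Fin.suc)))

Split : (ℕ → Set) → (ℕ → Set) → ℕ → Set
Split X Y n = Σ[ p ∈ ℕ ] Σ[ q ∈ ℕ ] (p ℕ.+ q ≡ n × X p × Y q)

Split-zero : ∀ {X Y} → (X 0 × Y 0) ↔ Split X Y 0
Split-zero = mk↔ₛ′
  (λ { (x , y) → 0 , 0 , refl , x , y })
  (λ { (zero , .0 , refl , x , y) → x , y })
  (λ { (zero , .0 , refl , x , y) → refl })
  (λ { (x , y) → refl })

Split-suc : ∀ {X Y n} → (X 0 × Y (suc n) ⊎ Split (X ∘ suc) Y n) ↔ Split X Y (suc n)
Split-suc = mk↔ₛ′
  (λ { (inj₁ (x , y)) → 0 , _ , refl , x , y ; (inj₂ (p , q , refl , x , y)) → suc p , q , refl , x , y })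
  (λ { (zero , _ , refl , x , y) → inj₁ (x , y) ; (suc p , q , refl , x , y) → inj₂ (p , q , refl , x , y) })
  (λ { (zero , _ , refl , x , y) → refl ; (suc p , q , refl , x , y) → refl })
  (λ { (inj₁ _) → refl ; (inj₂ (p , q , refl , x , y)) → refl })

-- Both hypotheses are bounded by n so that the induction in `count-Forest` can supply them.
count-Split : ∀ {X Y f g} n → (∀ p → p ≤ n → HasCount (X p) (f p)) → (∀ q → q ≤ n → HasCount (Y q) (g q)) →
              HasCount (Split X Y n) ((f ⊛ g) n)
count-Split zero    cX cY = count-↔ Split-zero (count-× (cX 0 z≤n) (cY 0 z≤n))
count-Split (suc n) cX cY = count-↔ Split-suc (count-⊎
  (count-× (cX 0 z≤n) (cY (suc n) ℕ.≤-refl))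
  (count-Split n (λ p p≤n → cX (suc p) (s≤s p≤n)) (λ q q≤n → cY q (ℕ.m≤n⇒m≤1+n q≤n))))

-- The type `a ≡ 1F` has as many elements as this number, so a choice among allowed colors is
-- counted by a weighted sum over all colors.
weight : Fin 2 → ℚ
weight 0F = 0ℚ
weight 1F = 1ℚ

count-≡1F : ∀ a → HasCount (a ≡ 1F) (weight a)
count-≡1F 0F = 0 , mk↔ₛ′ (λ ()) (λ ()) (λ ()) (λ ()) , refl
count-≡1F 1F = 1 , mk↔ₛ′ (λ _ → refl) (λ _ → 0F) (λ { refl → refl }) (λ { 0F → refl ; (Fin.suc ()) }) , refl

module Counting {m} (A : ColoringMatrix m) where

  -- The children of a root of color i: a forest with n vertices stands for a tree with n + 1
  -- vertices.
  Forest : Fin m → ℕ → Set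
  Forest i n = Σ[ ts ∈ List PlaneTree ]
    (verticesᶠ ts ≡ n × All (λ t → ∃[ j ] (A i j ≡ 1F × RootedColoring A j t)) ts)

  Forest-zero : ∀ {i} → ⊤ ↔ Forest i 0
  Forest-zero = mk↔ₛ′
    (λ _ → [] , refl , [])
    (λ _ → tt)
    (λ { ([] , refl , []) → refl ; (node _ ∷ _ , () , _) })
    (λ _ → refl)

  ChildForest : Fin m → ℕ → Set
  ChildForest i p = Σ[ j ∈ Fin m ] (A i j ≡ 1F × Forest j p)

  -- Split off the first tree and delete its root. The deleted vertex accounts for the difference
  -- between n + 1 and p + q = n.
  Forest-suc : ∀ {i n} → Split (ChildForest i) (Forest i) n ↔ Forest i (suc n)
  Forest-suc = mk↔ₛ′
    (λ { (_ , _ , refl , (j , a , us , refl , ds) , (ts , refl , cs)) → node us ∷ ts , refl , (j , a , node ds) ∷ cs })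
    (λ { (node us ∷ ts , refl , (j , a , node ds) ∷ cs) → _ , _ , refl , (j , a , us , refl , ds) , (ts , refl , cs) })
    (λ { (node us ∷ ts , refl , (j , a , node ds) ∷ cs) → refl })
    (λ { (_ , _ , refl , (j , a , us , refl , ds) , (ts , refl , cs)) → refl })

  ColoredTree-suc : ∀ {n} → Σ (Fin m) (λ i → Forest i n) ↔ ColoredTree A (suc n)
  ColoredTree-suc = mk↔ₛ′
    (λ { (i , ts , refl , cs) → node ts , refl , i , node cs })
    (λ { (node ts , refl , i , node cs) → i , ts , refl , cs })
    (λ { (node ts , refl , i , node cs) → refl })
    (λ { (i , ts , refl , cs) → refl })

  -- These are the coefficients of f_i = 1 + x · (Σ_j a_ij f_j) · f_i. They fix f recursively, so
  -- any rational solution gives the counts.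
  module _ (f : Fin m → ℕ → ℚ)
           (f-zero : ∀ i → f i 0 ≡ 1ℚ)
           (f-suc : ∀ i n → f i (suc n) ≡ ((λ p → sum (λ j → weight (A i j) * f j p)) ⊛ f i) n) where

    -- The recursive calls occur inside function arguments at sizes q ≤ p, so the bound n is what
    -- decreases structurally.
    count-Forest : ∀ n p → p ≤ n → ∀ i → HasCount (Forest i p) (f i p)
    count-Forest n zero p≤n i = subst (HasCount _) (sym (f-zero i)) (count-↔ Forest-zero (1 , 1↔⊤ , refl))
    count-Forest (suc n) (suc p) (s≤s p≤n) i = subst (HasCount _) (sym (f-suc i p)) (count-↔ Forest-suc
      (count-Split p
        (λ q q≤p → count-Σ λ j → count-× (count-≡1F (A i j)) (count-Forest n q (ℕ.≤-trans q≤p p≤n) j))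
        (λ q q≤p → count-Forest n q (ℕ.≤-trans q≤p p≤n) i)))

    count-ColoredTree : ∀ n → HasCount (ColoredTree A (suc n)) (sum (λ i → f i n))
    count-ColoredTree n = count-↔ ColoredTree-suc (count-Σ (count-Forest n n ℕ.≤-refl))

-- The rows of the coloring matrix

sum-zero : ∀ n (h : ℕ → ℚ) → (∀ e → h e ≡ 0ℚ) → sum {n} (h ∘ toℕ) ≡ 0ℚ
sum-zero zero    h h≡0 = refl
sum-zero (suc n) h h≡0 = cong₂ _+_ (h≡0 0) (sum-zero n (h ∘ suc) (h≡0 ∘ suc))

sum-telescope : ∀ n (h V : ℕ → ℚ) → (∀ e → h e ≡ V e - V (suc e)) → sum {n} (h ∘ toℕ) ≡ V 0 - V n
sum-telescope zero    h V eq = sym (+-inverseʳ (V 0))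
sum-telescope (suc n) h V eq = begin
  h 0 + sum {n} (h ∘ suc ∘ toℕ)    ≡⟨ cong₂ _+_ (eq 0) (sum-telescope n (h ∘ suc) (V ∘ suc) (eq ∘ suc)) ⟩
  V 0 - V 1 + (V 1 - V (suc n))    ≡⟨ solve 3 (λ x y z → x :- y :+ (y :- z) := x :- z) refl (V 0) (V 1) (V (suc n)) ⟩
  V 0 - V (suc n)                  ∎

-- The term at d stays free: in a row of the matrix it is the pair of columns in which only one
-- entry is 1.
sum-telescope-until : ∀ d k (h V : ℕ → ℚ) → (∀ e → e < d → h e ≡ V e - V (suc e)) → (∀ e → d < e → h e ≡ 0ℚ) →
                      sum {suc d ℕ.+ k} (h ∘ toℕ) ≡ V 0 - V d + h d
sum-telescope-until zero k h V below above = begin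
  h 0 + sum {k} (h ∘ suc ∘ toℕ)  ≡⟨ cong (λ r → h 0 + r) (sum-zero k (h ∘ suc) (λ e → above (suc e) (s≤s z≤n))) ⟩
  h 0 + 0ℚ                       ≡⟨ solve 2 (λ x y → x :+ con 0ℚ := y :- y :+ x) refl (h 0) (V 0) ⟩
  V 0 - V 0 + h 0                ∎
sum-telescope-until (suc d) k h V below above = begin
  h 0 + sum {suc d ℕ.+ k} (h ∘ suc ∘ toℕ)
    ≡⟨ cong₂ _+_ (below 0 (s≤s z≤n))
         (sum-telescope-until d k (h ∘ suc) (V ∘ suc) (λ e → below (suc e) ∘ s≤s) (λ e → above (suc e) ∘ s≤s)) ⟩
  V 0 - V 1 + (V 1 - V (suc d) + h (suc d))
    ≡⟨ solve 4 (λ x y z w → x :- y :+ (y :- z :+ w) := x :- z :+ w) refl (V 0) (V 1) (V (suc d)) (h (suc d)) ⟩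
  V 0 - V (suc d) + h (suc d) ∎

sum-pairs : ∀ n (h : ℕ → ℚ) →
            sum {n ℕ.* 2} (h ∘ toℕ) ≡ sum {n} (λ k → h (toℕ k ℕ.* 2) + h (suc (toℕ k ℕ.* 2)))
sum-pairs zero    h = refl
sum-pairs (suc n) h = begin
  h 0 + (h 1 + tail)  ≡⟨ +-assoc (h 0) (h 1) tail ⟨
  h 0 + h 1 + tail    ≡⟨ cong (λ r → h 0 + h 1 + r) (sum-pairs n (λ j → h (2 ℕ.+ j))) ⟩
  h 0 + h 1 + sum {n} (λ k → h (2 ℕ.+ toℕ k ℕ.* 2) + h (3 ℕ.+ toℕ k ℕ.* 2)) ∎
  where
  tail : ℚ
  tail = sum {n ℕ.* 2} (λ j → h (2 ℕ.+ toℕ j))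

⌊n*2/2⌋≡n : ∀ n → ⌊ n ℕ.* 2 /2⌋ ≡ n
⌊n*2/2⌋≡n zero    = refl
⌊n*2/2⌋≡n (suc n) = cong suc (⌊n*2/2⌋≡n n)

⌊1+n*2/2⌋≡n : ∀ n → ⌊ suc (n ℕ.* 2) /2⌋ ≡ n
⌊1+n*2/2⌋≡n zero    = refl
⌊1+n*2/2⌋≡n (suc n) = cong suc (⌊1+n*2/2⌋≡n n)

double : ∀ x y → ½ * (x - y) + ½ * (x - y) ≡ x - y
double x y = solve 2 (λ x y → con ½ :* (x :- y) :+ con ½ :* (x :- y) := x :- y) refl x y

-- C⁽ m ⁾ k l is definitionally entry m (toℕ k) (toℕ l).
entry : ℕ → ℕ → ℕ → Fin 2
entry m k l =
  let i = suc k
      j = suc l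
      exceptional = does (i ℕ.+ j ≟ m) ∧ does (i % 2 ≟ 1) ∧ does (j % 2 ≟ 1)
  in if does (i ℕ.+ j ≤? m ℕ.+ 1) ∧ not exceptional then 1F else 0F

module _ (m k l : ℕ) where

  entry-large : ¬ suc k ℕ.+ suc l ≤ m ℕ.+ 1 → entry m k l ≡ 0F
  entry-large large rewrite dec-false (suc k ℕ.+ suc l ≤? m ℕ.+ 1) large = refl

  entry-exceptional : suc k ℕ.+ suc l ≡ m → suc k % 2 ≡ 1 → suc l % 2 ≡ 1 → entry m k l ≡ 0F
  entry-exceptional eq odd₁ odd₂
    rewrite dec-true (suc k ℕ.+ suc l ≟ m) eq | dec-true (suc k % 2 ≟ 1) odd₁ | dec-true (suc l % 2 ≟ 1) odd₂
    with does (suc k ℕ.+ suc l ≤? m ℕ.+ 1)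
  ... | true  = refl
  ... | false = refl

  entry-regular : suc k ℕ.+ suc l ≤ m ℕ.+ 1 → (suc k ℕ.+ suc l ≢ m) ⊎ (suc k % 2 ≢ 1) ⊎ (suc l % 2 ≢ 1) → entry m k l ≡ 1F
  entry-regular small reg rewrite dec-true (suc k ℕ.+ suc l ≤? m ℕ.+ 1) small with reg
  ... | inj₁ ne rewrite dec-false (suc k ℕ.+ suc l ≟ m) ne = refl
  ... | inj₂ (inj₁ even₁) rewrite dec-false (suc k % 2 ≟ 1) even₁ | ∧-zeroʳ (does (suc k ℕ.+ suc l ≟ m)) = refl
  ... | inj₂ (inj₂ even₂) rewrite dec-false (suc l % 2 ≟ 1) even₂ | ∧-zeroʳ (does (suc k % 2 ≟ 1))
                                | ∧-zeroʳ (does (suc k ℕ.+ suc l ≟ m)) = refl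

-- The names refer to colors counted from 0. Counted from 1, `evenRow` is the odd index 2k + 1, so
-- exceptional entries lie only in even rows.
data InRow (k : ℕ) : ℕ → Set where
  evenRow : InRow k (k ℕ.* 2)
  oddRow  : InRow k (suc (k ℕ.* 2))

inRow : ∀ i → ∃[ k ] InRow k i
inRow zero          = 0 , evenRow
inRow (suc zero)    = 0 , oddRow
inRow (suc (suc i)) with inRow i
... | k , evenRow = suc k , evenRow
... | k , oddRow  = suc k , oddRow

InRow⇒⌊/2⌋ : ∀ {k i} → InRow k i → ⌊ i /2⌋ ≡ k
InRow⇒⌊/2⌋ {k} evenRow = ⌊n*2/2⌋≡n k
InRow⇒⌊/2⌋ {k} oddRow  = ⌊1+n*2/2⌋≡n k

InRow⇒≤ : ∀ {k i} → InRow k i → k ℕ.* 2 ≤ i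
InRow⇒≤ evenRow = ℕ.≤-refl
InRow⇒≤ oddRow  = ℕ.n≤1+n _

InRow⇒complement : ∀ {k i ℓ} → InRow k i → i < ℓ ℕ.* 2 → ∃[ d ] ℓ ≡ suc (d ℕ.+ k)
InRow⇒complement {k} {ℓ = ℓ} row i<ℓ*2
  with d , eq ← ℕ.m≤n⇒∃[o]m+o≡n (ℕ.*-cancelʳ-< 2 k ℓ (ℕ.≤-<-trans (InRow⇒≤ row) i<ℓ*2))
  = d , trans (sym eq) (cong suc (ℕ.+-comm k d))

-- Taking d and k as parameters makes ℓ the expression `suc d + k`, free of truncated subtraction
-- and of the shape `sum-telescope-until` expects.
module Row (d k : ℕ) where

  m : ℕ
  m = (suc d ℕ.+ k) ℕ.* 2

  -- The index sum i + j, counted from 1, at the first entry of pair e in the even row. It equals m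
  -- exactly at e = d. The even row has sums `diagonal e` and one more; the odd row has these
  -- shifted by 1.
  diagonal : ℕ → ℕ
  diagonal e = (suc e ℕ.+ k) ℕ.* 2

  diagonal-mono : ∀ {e e′} → e ≤ e′ → diagonal e ≤ diagonal e′
  diagonal-mono e≤e′ = ℕ.*-monoˡ-≤ 2 (s≤s (ℕ.+-monoˡ-≤ k e≤e′))

  even-even : ∀ e → suc (k ℕ.* 2) ℕ.+ suc (e ℕ.* 2) ≡ diagonal e
  even-even e = cong suc (trans (ℕ.+-suc (k ℕ.* 2) (e ℕ.* 2))
    (cong suc (trans (ℕ.+-comm (k ℕ.* 2) (e ℕ.* 2)) (sym (ℕ.*-distribʳ-+ 2 e k)))))

  even-odd : ∀ e → suc (k ℕ.* 2) ℕ.+ suc (suc (e ℕ.* 2)) ≡ suc (diagonal e)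
  even-odd e = trans (ℕ.+-suc (suc (k ℕ.* 2)) (suc (e ℕ.* 2))) (cong suc (even-even e))

  small : ∀ {i} e → i ≡ suc (diagonal e) → e ≤ d → i ≤ m ℕ.+ 1
  small e refl e≤d = subst (suc (diagonal e) ≤_) (ℕ.+-comm 1 m) (s≤s (diagonal-mono e≤d))

  large : ∀ {i} e → diagonal e ≤ i → d < e → ¬ i ≤ m ℕ.+ 1
  large e de≤i d<e i≤m+1 = ℕ.<⇒≱ (subst (_< suc (suc m)) (ℕ.+-comm 1 m) ℕ.≤-refl)
    (ℕ.≤-trans (diagonal-mono d<e) (ℕ.≤-trans de≤i i≤m+1))

  odd : ∀ n → suc (n ℕ.* 2) % 2 ≡ 1
  odd n = [m+kn]%n≡m%n 1 n 2

  even : ∀ n → suc (suc (n ℕ.* 2)) % 2 ≢ 1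
  even n eq with trans (sym ([m+kn]%n≡m%n 2 n 2)) eq
  ... | ()

  pair : ℕ → ℕ → ℚ → ℚ
  pair i e r = weight (entry m i (e ℕ.* 2)) * r + weight (entry m i (suc (e ℕ.* 2))) * r

  pair-cong : ∀ i e r {x y} → entry m i (e ℕ.* 2) ≡ x → entry m i (suc (e ℕ.* 2)) ≡ y →
              pair i e r ≡ weight x * r + weight y * r
  pair-cong i e r = cong₂ (λ x y → weight x * r + weight y * r)

  pair-below : ∀ {i} e r → InRow k i → e < d → pair i e r ≡ r + r
  pair-below e r row e<d = trans (entries row) (cong₂ _+_ (*-identityˡ r) (*-identityˡ r))
    where
    e≤d = ℕ.<⇒≤ e<d

    entries : ∀ {i} → InRow k i → pair i e r ≡ 1ℚ * r + 1ℚ * r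
    entries evenRow = pair-cong (k ℕ.* 2) e r
      (entry-regular m (k ℕ.* 2) (e ℕ.* 2)
        (subst (_≤ m ℕ.+ 1) (sym (even-even e)) (ℕ.≤-trans (ℕ.n≤1+n _) (small e refl e≤d)))
        -- Both indices are odd here, so the entry is regular only because its index sum is below m.
        (inj₁ λ eq → ℕ.<⇒≢ (ℕ.*-monoˡ-< 2 (s≤s (ℕ.+-monoˡ-< k e<d))) (trans (sym (even-even e)) eq)))
      (entry-regular m (k ℕ.* 2) (suc (e ℕ.* 2)) (small e (even-odd e) e≤d) (inj₂ (inj₂ (even e))))
    entries oddRow = pair-cong (suc (k ℕ.* 2)) e r
      (entry-regular m (suc (k ℕ.* 2)) (e ℕ.* 2) (small e (cong suc (even-even e)) e≤d) (inj₂ (inj₁ (even k))))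
      (entry-regular m (suc (k ℕ.* 2)) (suc (e ℕ.* 2))
        (subst (_≤ m ℕ.+ 1) (sym (cong suc (even-odd e)))
          (ℕ.≤-trans (diagonal-mono e<d) (ℕ.m≤m+n m 1)))
        (inj₂ (inj₁ (even k))))

  -- The exception in the matrix makes the two rows agree: the even row has index sums m
  -- (exceptional) and m + 1 (allowed), the odd row m + 1 (allowed) and m + 2 (too large).
  pair-at : ∀ {i} r → InRow k i → pair i d r ≡ r
  pair-at r evenRow = trans
    (pair-cong (k ℕ.* 2) d r
      (entry-exceptional m (k ℕ.* 2) (d ℕ.* 2) (even-even d) (odd k) (odd d))
      (entry-regular m (k ℕ.* 2) (suc (d ℕ.* 2)) (small d (even-odd d) ℕ.≤-refl) (inj₂ (inj₂ (even d)))))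
    (solve 1 (λ r → con 0ℚ :* r :+ con 1ℚ :* r := r) refl r)
  pair-at r oddRow = trans
    (pair-cong (suc (k ℕ.* 2)) d r
      (entry-regular m (suc (k ℕ.* 2)) (d ℕ.* 2) (small d (cong suc (even-even d)) ℕ.≤-refl) (inj₂ (inj₁ (even k))))
      (entry-large m (suc (k ℕ.* 2)) (suc (d ℕ.* 2))
        (large (suc d) (ℕ.≤-reflexive (sym (cong suc (even-odd d)))) ℕ.≤-refl)))
    (solve 1 (λ r → con 1ℚ :* r :+ con 0ℚ :* r := r) refl r)

  pair-above : ∀ {i} e r → InRow k i → d < e → pair i e r ≡ 0ℚ
  pair-above e r row d<e = trans (entries row) (solve 1 (λ r → con 0ℚ :* r :+ con 0ℚ :* r := con 0ℚ) refl r)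
    where
    entries : ∀ {i} → InRow k i → pair i e r ≡ 0ℚ * r + 0ℚ * r
    entries evenRow = pair-cong (k ℕ.* 2) e r
      (entry-large m (k ℕ.* 2) (e ℕ.* 2) (large e (ℕ.≤-reflexive (sym (even-even e))) d<e))
      (entry-large m (k ℕ.* 2) (suc (e ℕ.* 2))
        (large e (ℕ.≤-trans (ℕ.n≤1+n _) (ℕ.≤-reflexive (sym (even-odd e)))) d<e))
    entries oddRow = pair-cong (suc (k ℕ.* 2)) e r
      (entry-large m (suc (k ℕ.* 2)) (e ℕ.* 2)
        (large e (ℕ.≤-trans (ℕ.n≤1+n _) (ℕ.≤-reflexive (sym (cong suc (even-even e))))) d<e))
      (entry-large m (suc (k ℕ.* 2)) (suc (e ℕ.* 2))
        (large e (ℕ.≤-trans (ℕ.m≤n+m _ 2) (ℕ.≤-reflexive (sym (cong suc (even-odd e))))) d<e))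

  -- Full pairs contribute V e - V (e + 1), and the single entry at d half of that, which turns -V d
  -- into minus an average. V is arbitrary so that it can be a fixed coefficient of all the U e.
  row-sum : ∀ {i} (V : ℕ → ℚ) → InRow k i → let R = λ e → ½ * (V e - V (suc e)) in
            sum {m} (λ j → weight (entry m i (toℕ j)) * R ⌊ toℕ j /2⌋) ≡ V 0 - ½ * (V d + V (suc d))
  row-sum {i} V row = begin
    sum {m} (λ j → weight (entry m i (toℕ j)) * R ⌊ toℕ j /2⌋)
      ≡⟨ sum-pairs (suc d ℕ.+ k) (λ j → weight (entry m i j) * R ⌊ j /2⌋) ⟩
    sum {suc d ℕ.+ k} (λ e → weight (entry m i (toℕ e ℕ.* 2)) * R ⌊ toℕ e ℕ.* 2 /2⌋
                           + weight (entry m i (suc (toℕ e ℕ.* 2))) * R ⌊ suc (toℕ e ℕ.* 2) /2⌋)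
      ≡⟨ sum-cong-≗ {suc d ℕ.+ k} (λ e → cong₂ (λ x y → weight (entry m i (toℕ e ℕ.* 2)) * R x + weight (entry m i (suc (toℕ e ℕ.* 2))) * R y)
           (⌊n*2/2⌋≡n (toℕ e)) (⌊1+n*2/2⌋≡n (toℕ e))) ⟩
    sum {suc d ℕ.+ k} (λ e → pair i (toℕ e) (R (toℕ e)))
      ≡⟨ sum-telescope-until d k (λ e → pair i e (R e)) V
           (λ e e<d → trans (pair-below e (R e) row e<d) (double (V e) (V (suc e))))
           (λ e → pair-above e (R e) row) ⟩
    V 0 - V d + pair i d (R d)
      ≡⟨ cong (λ r → V 0 - V d + r) (pair-at (R d) row) ⟩
    V 0 - V d + R d
      ≡⟨ solve 3 (λ x y z → x :- y :+ con ½ :* (y :- z) := x :- con ½ :* (y :+ z)) refl (V 0) (V d) (V (suc d)) ⟩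
    V 0 - ½ * (V d + V (suc d)) ∎
    where
    R : ℕ → ℚ
    R e = ½ * (V e - V (suc e))

-- The generating functions of the colors

module Colors (ℓ : ℕ) where

  z : ℚ
  z = fromℕ 4

  open Rothe (½ * fromℕ (suc ℓ)) z

  U R : ℕ → ℕ → ℚ
  U k = F (- (½ * fromℕ k))
  R k n = ½ * (U k n - U (suc k) n)

  U-⊛ : ∀ j k n → (U j ⊛ U k) n ≡ U (j ℕ.+ k) n
  U-⊛ j k n = trans (F-⊛ (- (½ * fromℕ j)) (- (½ * fromℕ k)) n) (cong (λ r → F r n) (begin
    - (½ * fromℕ j) + - (½ * fromℕ k)
      ≡⟨ solve 2 (λ j k → :- (con ½ :* j) :+ :- (con ½ :* k) := :- (con ½ :* (j :+ k))) refl (fromℕ j) (fromℕ k) ⟩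
    - (½ * (fromℕ j + fromℕ k))
      ≡⟨ cong (λ r → - (½ * r)) (fromℕ-homo-+ j k) ⟨
    - (½ * fromℕ (j ℕ.+ k)) ∎))

  U₀-suc : ∀ n → U 0 (suc n) ≡ 0ℚ
  U₀-suc n = solve 2 (λ z f → z :* (con 0ℚ :* f) := con 0ℚ) refl
    (z ^ℚ suc n) (fallingFactorial (top (- (½ * fromℕ 0)) (suc n)) n * 1/! (suc n))

  -- At a = -(ℓ-1)/2 the parameters a - 1 and a + b - 1 of Pascal's rule are -(ℓ+1)/2 and 0.
  U-step : ∀ {l} → ℓ ≡ suc l → ∀ n → U l (suc n) ≡ U (suc ℓ) (suc n) + z * U 0 n
  U-step {l} refl n = begin
    F a (suc n)
      ≡⟨ F-pascal a n ⟩
    F (a - 1ℚ) (suc n) + z * F (a + ½ * fromℕ (suc (suc l)) - 1ℚ) n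
      ≡⟨ cong₂ (λ x y → F x (suc n) + z * F y n)
           (trans (solve 1 (λ l → :- (con ½ :* l) :- con 1ℚ := :- (con ½ :* (con 1ℚ :+ (con 1ℚ :+ l)))) refl (fromℕ l))
             (cong (λ r → - (½ * r)) (sym 2+l)))
           (trans (cong (λ r → a + ½ * r - 1ℚ) 2+l)
             (solve 1 (λ l → :- (con ½ :* l) :+ con ½ :* (con 1ℚ :+ (con 1ℚ :+ l)) :- con 1ℚ := con 0ℚ) refl (fromℕ l))) ⟩
    U (suc (suc l)) (suc n) + z * U 0 n ∎
    where
    a = - (½ * fromℕ l)

    2+l : fromℕ (suc (suc l)) ≡ 1ℚ + (1ℚ + fromℕ l)
    2+l = trans (fromℕ-suc (suc l)) (cong (λ r → 1ℚ + r) (fromℕ-suc l))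

  W : ℕ → ℕ → ℚ
  W d n = ½ * U d n + ½ * U (suc d) n

  -- Of the four products, U d · U (k + 1) and U (d + 1) · U k are the same series and cancel. As
  -- `U 0` is the constant 1, the right side is the series x.
  W-⊛-R : ∀ d k → ℓ ≡ suc (d ℕ.+ k) → ∀ n → (W d ⊛ R k) (suc n) ≡ U 0 n
  W-⊛-R d k eq n = begin
    (W d ⊛ R k) s
      ≡⟨ ⊛-linearˡ ½ ½ (U d) (U (suc d)) (R k) s ⟩
    ½ * (U d ⊛ R k) s + ½ * (U (suc d) ⊛ R k) s
      ≡⟨ cong₂ (λ x y → ½ * x + ½ * y) (expand d) (expand (suc d)) ⟩
    ½ * (½ * u₀ - ½ * U (d ℕ.+ suc k) s) + ½ * (½ * U (suc d ℕ.+ k) s - ½ * U (suc d ℕ.+ suc k) s)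
      ≡⟨ cong₂ (λ x y → ½ * (½ * u₀ - ½ * U x s) + ½ * (½ * u₁ - ½ * U (suc y) s)) (ℕ.+-suc d k)
           (trans (ℕ.+-suc d k) (sym eq)) ⟩
    ½ * (½ * u₀ - ½ * u₁) + ½ * (½ * u₁ - ½ * u₂)
      ≡⟨ cong (λ x → ½ * (½ * x - ½ * u₁) + ½ * (½ * u₁ - ½ * u₂)) (U-step eq n) ⟩
    ½ * (½ * (u₂ + z * U 0 n) - ½ * u₁) + ½ * (½ * u₁ - ½ * u₂)
      ≡⟨ solve 3 (λ u₁ u₂ v → con ½ :* (con ½ :* (u₂ :+ con z :* v) :- con ½ :* u₁)
            :+ con ½ :* (con ½ :* u₁ :- con ½ :* u₂) := v) refl u₁ u₂ (U 0 n) ⟩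
    U 0 n ∎
    where
    s = suc n
    u₀ = U (d ℕ.+ k) s
    u₁ = U (suc (d ℕ.+ k)) s
    u₂ = U (suc ℓ) s

    expand : ∀ e → (U e ⊛ R k) s ≡ ½ * U (e ℕ.+ k) s - ½ * U (e ℕ.+ suc k) s
    expand e = begin
      (U e ⊛ R k) s
        ≡⟨ ⊛-comm (U e) (R k) s ⟩
      (R k ⊛ U e) s
        ≡⟨ ⊛-congˡ (U e) s (λ p → solve 2 (λ x y → con ½ :* (x :- y) := con ½ :* x :+ con (- ½) :* y) refl (U k p) (U (suc k) p)) ⟩
      ((λ p → ½ * U k p + - ½ * U (suc k) p) ⊛ U e) s
        ≡⟨ ⊛-linearˡ ½ (- ½) (U k) (U (suc k)) (U e) s ⟩
      ½ * (U k ⊛ U e) s + - ½ * (U (suc k) ⊛ U e) s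
        ≡⟨ cong₂ (λ x y → ½ * x + - ½ * y) (trans (⊛-comm (U k) (U e) s) (U-⊛ e k s))
             (trans (⊛-comm (U (suc k)) (U e) s) (U-⊛ e (suc k) s)) ⟩
      ½ * U (e ℕ.+ k) s + - ½ * U (e ℕ.+ suc k) s
        ≡⟨ solve 2 (λ x y → con ½ :* x :+ con (- ½) :* y := con ½ :* x :- con ½ :* y) refl (U (e ℕ.+ k) s) (U (e ℕ.+ suc k) s) ⟩
      ½ * U (e ℕ.+ k) s - ½ * U (e ℕ.+ suc k) s ∎

  R-one : ∀ d k → ℓ ≡ suc (d ℕ.+ k) → R k 1 ≡ 1ℚ
  R-one d k eq = begin
    -- `W d 0` computes to 1 and `R k 0` to 0.
    R k 1                    ≡⟨ solve 2 (λ r w → r := con 1ℚ :* r :+ w :* con 0ℚ) refl (R k 1) (W d 1) ⟩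
    1ℚ * R k 1 + W d 1 * 0ℚ  ≡⟨ W-⊛-R d k eq 0 ⟩
    1ℚ                       ∎

  -- Solve W d · R k = x for the highest coefficient of R k, as W d has constant term 1 and R k has
  -- none. The kernel is -W d; the vanishing `U 0 (suc p)` is inserted to match the row sum.
  R-suc : ∀ d k → ℓ ≡ suc (d ℕ.+ k) → ∀ n →
          R k (suc (suc n)) ≡ ((λ p → U 0 (suc p) - ½ * (U d (suc p) + U (suc d) (suc p))) ⊛ R k ∘ suc) n
  R-suc d k eq n = begin
    R k (2 ℕ.+ n)
      ≡⟨ solve 3 (λ r w v → r := con 1ℚ :* r :+ (w :+ v :* con 0ℚ) :- w) refl (R k (2 ℕ.+ n)) c (W d (2 ℕ.+ n)) ⟩
    1ℚ * R k (2 ℕ.+ n) + (c + W d (2 ℕ.+ n) * 0ℚ) - c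
      ≡⟨ cong (λ r → 1ℚ * R k (2 ℕ.+ n) + r - c) (⊛-sucʳ (W d ∘ suc) (R k) n) ⟨
    (W d ⊛ R k) (2 ℕ.+ n) - c
      ≡⟨ cong (_- c) (trans (W-⊛-R d k eq (suc n)) (U₀-suc n)) ⟩
    0ℚ - c
      ≡⟨ solve 1 (λ c → con 0ℚ :- c := con (- 1ℚ) :* c :+ con 0ℚ :* c) refl c ⟩
    - 1ℚ * c + 0ℚ * c
      ≡⟨ ⊛-linearˡ (- 1ℚ) 0ℚ (W d ∘ suc) (W d ∘ suc) (R k ∘ suc) n ⟨
    ((λ p → - 1ℚ * W d (suc p) + 0ℚ * W d (suc p)) ⊛ R k ∘ suc) n
      ≡⟨ ⊛-congˡ (R k ∘ suc) n (λ p → trans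
           (solve 2 (λ x y → let w = con ½ :* x :+ con ½ :* y in
               con (- 1ℚ) :* w :+ con 0ℚ :* w := con 0ℚ :- con ½ :* (x :+ y)) refl (U d (suc p)) (U (suc d) (suc p)))
           (cong (_- ½ * (U d (suc p) + U (suc d) (suc p))) (sym (U₀-suc p)))) ⟩
    ((λ p → U 0 (suc p) - ½ * (U d (suc p) + U (suc d) (suc p))) ⊛ R k ∘ suc) n ∎
    where
    c = (W d ∘ suc ⊛ R k ∘ suc) n

  -- The shift by one passes from trees, counted by R, to the forests below their roots.
  series : Fin (ℓ ℕ.* 2) → ℕ → ℚ
  series i n = R ⌊ toℕ i /2⌋ (suc n)

  locate : (i : Fin (ℓ ℕ.* 2)) → ∃[ k ] ∃[ d ] (InRow k (toℕ i) × ℓ ≡ suc (d ℕ.+ k))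
  locate i =
    let k , row = inRow (toℕ i)
        d , ℓ≡  = InRow⇒complement row (toℕ<n i)
    in k , d , row , ℓ≡

  series-zero : ∀ i → series i 0 ≡ 1ℚ
  series-zero i =
    let k , d , row , ℓ≡ = locate i
    in trans (cong (λ h → R h 1) (InRow⇒⌊/2⌋ row)) (R-one d k ℓ≡)

  row-sum : ∀ {d k i} → ℓ ≡ suc (d ℕ.+ k) → InRow k i → ∀ p →
            sum {ℓ ℕ.* 2} (λ j → weight (entry (ℓ ℕ.* 2) i (toℕ j)) * series j p)
              ≡ U 0 (suc p) - ½ * (U d (suc p) + U (suc d) (suc p))
  -- Only the matrix size is transported: `entry` takes the row as a natural number, so i has no
  -- dependence on ℓ.
  row-sum {d} {k} {i} ℓ≡ row p = subst
    (λ ℓ′ → sum {ℓ′ ℕ.* 2} (λ j → weight (entry (ℓ′ ℕ.* 2) i (toℕ j)) * R ⌊ toℕ j /2⌋ (suc p))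
              ≡ U 0 (suc p) - ½ * (U d (suc p) + U (suc d) (suc p)))
    (sym ℓ≡) (Row.row-sum d k (λ e → U e (suc p)) row)

  series-suc : ∀ i n →
               series i (suc n) ≡ ((λ p → sum (λ j → weight (C⁽ ℓ ℕ.* 2 ⁾ i j) * series j p)) ⊛ series i) n
  series-suc i n =
    let k , d , row , ℓ≡ = locate i
    in subst
         (λ h → R h (suc (suc n)) ≡
                ((λ p → sum (λ j → weight (C⁽ ℓ ℕ.* 2 ⁾ i j) * series j p)) ⊛ R h ∘ suc) n)
         (sym (InRow⇒⌊/2⌋ row))
         (trans (R-suc d k ℓ≡ n) (⊛-congˡ (R k ∘ suc) n (λ p → sym (row-sum ℓ≡ row p))))

  total : ∀ n → sum (λ i → series i n) ≡ - U ℓ (suc n)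
  total n = begin
    sum (λ i → series i n)
      ≡⟨ sum-pairs ℓ (λ j → R ⌊ j /2⌋ (suc n)) ⟩
    sum {ℓ} (λ e → R ⌊ toℕ e ℕ.* 2 /2⌋ (suc n) + R ⌊ suc (toℕ e ℕ.* 2) /2⌋ (suc n))
      ≡⟨ sum-telescope ℓ (λ e → R ⌊ e ℕ.* 2 /2⌋ (suc n) + R ⌊ suc (e ℕ.* 2) /2⌋ (suc n)) (λ e → U e (suc n))
           (λ e → trans (cong₂ (λ x y → R x (suc n) + R y (suc n)) (⌊n*2/2⌋≡n e) (⌊1+n*2/2⌋≡n e))
                    (double (U e (suc n)) (U (suc e) (suc n)))) ⟩
    U 0 (suc n) - U ℓ (suc n)
      ≡⟨ cong (_- U ℓ (suc n)) (U₀-suc n) ⟩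
    0ℚ - U ℓ (suc n)
      ≡⟨ +-identityˡ (- U ℓ (suc n)) ⟩
    - U ℓ (suc n) ∎

-- The closed form of the coefficients

fromℕ-homo-^ : ∀ m n → fromℕ (m ^ n) ≡ fromℕ m ^ℚ n
fromℕ-homo-^ m zero    = refl
fromℕ-homo-^ m (suc n) = trans (fromℕ-homo-* m (m ^ n)) (cong (fromℕ m *_) (fromℕ-homo-^ m n))

2^[2n∸1] : ∀ n → fromℕ (2 ^ (2 ℕ.* suc n ∸ 1)) ≡ ½ * fromℕ 4 ^ℚ suc n
2^[2n∸1] n = begin
  fromℕ (2 ^ (n ℕ.+ suc (n ℕ.+ 0)))  ≡⟨ cong (λ e → fromℕ (2 ^ e)) (ℕ.+-suc n (n ℕ.+ 0)) ⟩
  fromℕ (2 ℕ.* 2 ^ (2 ℕ.* n))        ≡⟨ fromℕ-homo-* 2 (2 ^ (2 ℕ.* n)) ⟩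
  fromℕ 2 * fromℕ (2 ^ (2 ℕ.* n))    ≡⟨ cong (λ e → fromℕ 2 * fromℕ e) (ℕ.^-*-assoc 2 2 n) ⟨
  fromℕ 2 * fromℕ (4 ^ n)            ≡⟨ cong (fromℕ 2 *_) (fromℕ-homo-^ 4 n) ⟩
  fromℕ 2 * fromℕ 4 ^ℚ n             ≡⟨ solve 1 (λ x → con (fromℕ 2) :* x := con ½ :* (con (fromℕ 4) :* x)) refl
                                          (fromℕ 4 ^ℚ n) ⟩
  ½ * fromℕ 4 ^ℚ suc n               ∎

-- The factor a = -ℓ/2 in F cancels the sign and gives ℓ; its half turns 4^(n+1) into 2^(2(n+1)-1),
-- and 1/(n + 1)! splits into 1/(n + 1) and the denominator of the binomial.
closed-form : ∀ ℓ n → - Colors.U ℓ ℓ (suc n) ≡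
  (+ ℓ / suc n) * fromℕ (2 ^ (2 ℕ.* suc n ∸ 1))
  * binomial ((+ (ℓ ℕ.+ 1) / 2) * fromℕ (suc n) - (+ ℓ / 2) - 1ℚ) n
closed-form ℓ n = begin
  - (Z * (- (½ * L) * (fallingFactorial y n * 1/! (suc n))))
    ≡⟨ solve 4 (λ Z L f i → :- (Z :* (:- (con ½ :* L) :* (f :* i))) := L :* (con ½ :* Z) :* (f :* i)) refl
         Z L (fallingFactorial y n) (1/! (suc n)) ⟩
  L * (½ * Z) * (fallingFactorial y n * 1/! (suc n))
    ≡⟨ cong₂ (λ x i → L * (½ * Z) * (fallingFactorial x n * i)) y≡ 1/!-suc′ ⟩
  L * (½ * Z) * (fallingFactorial y′ n * ((+ 1 / suc n) * 1/! n))
    ≡⟨ solve 5 (λ L Z f r i → L :* Z :* (f :* (r :* i)) := L :* r :* Z :* (f :* i)) refl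
         L (½ * Z) (fallingFactorial y′ n) (+ 1 / suc n) (1/! n) ⟩
  L * (+ 1 / suc n) * (½ * Z) * binomial y′ n
    ≡⟨ cong₂ (λ x e → x * e * binomial y′ n) (/-split ℓ (suc n)) (2^[2n∸1] n) ⟨
  (+ ℓ / suc n) * fromℕ (2 ^ (2 ℕ.* suc n ∸ 1)) * binomial y′ n ∎
  where
  Z = fromℕ 4 ^ℚ suc n
  L = fromℕ ℓ
  y = - (½ * L) + ½ * fromℕ (suc ℓ) * fromℕ (suc n) - 1ℚ
  y′ = (+ (ℓ ℕ.+ 1) / 2) * fromℕ (suc n) - (+ ℓ / 2) - 1ℚ

  y≡ : y ≡ y′
  y≡ = begin
    - (½ * L) + ½ * fromℕ (suc ℓ) * fromℕ (suc n) - 1ℚ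
      ≡⟨ solve 3 (λ L M N → :- (con ½ :* L) :+ con ½ :* M :* N :- con 1ℚ := M :* con ½ :* N :- L :* con ½ :- con 1ℚ) refl
           L (fromℕ (suc ℓ)) (fromℕ (suc n)) ⟩
    fromℕ (suc ℓ) * ½ * fromℕ (suc n) - L * ½ - 1ℚ
      ≡⟨ cong₂ (λ p q → p * fromℕ (suc n) - q - 1ℚ) (/-split (suc ℓ) 2) (/-split ℓ 2) ⟨
    (+ suc ℓ / 2) * fromℕ (suc n) - (+ ℓ / 2) - 1ℚ
      ≡⟨ cong (λ m → (+ m / 2) * fromℕ (suc n) - (+ ℓ / 2) - 1ℚ) (ℕ.+-comm 1 ℓ) ⟩
    y′ ∎

  1/!-suc′ : 1/! (suc n) ≡ (+ 1 / suc n) * 1/! n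
  1/!-suc′ = fromℕ-suc-*-cancelˡ n (begin
    fromℕ (suc n) * 1/! (suc n)               ≡⟨ 1/!-suc n ⟩
    1/! n                                     ≡⟨ *-identityˡ (1/! n) ⟨
    1ℚ * 1/! n                                ≡⟨ cong (_* 1/! n) (fromℕ-*-1/ (suc n)) ⟨
    fromℕ (suc n) * (+ 1 / suc n) * 1/! n     ≡⟨ *-assoc (fromℕ (suc n)) (+ 1 / suc n) (1/! n) ⟩
    fromℕ (suc n) * ((+ 1 / suc n) * 1/! n)   ∎)

theorem38 : (ℓ n : ℕ) .{{_ : NonZero ℓ}} .{{_ : NonZero n}} →
    ∃[ t ] ((Fin t ↔ ColoredTree C⁽ 2 ℕ.* ℓ ⁾ n) ×
    (fromℕ t ≡ (+ ℓ / n) * fromℕ (2 ^ (2 ℕ.* n ∸ 1))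
    * binomial ((+ (ℓ ℕ.+ 1) / 2) * fromℕ n - (+ ℓ / 2) - 1ℚ) (n ∸ 1)))
-- The count is done with ℓ * 2 colors, since that product unfolds two colors at a time by recursion
-- on ℓ.
theorem38 ℓ (suc n) = subst₂ (λ m q → HasCount (ColoredTree C⁽ m ⁾ (suc n)) q)
  (ℕ.*-comm ℓ 2) (trans (total n) (closed-form ℓ n))
  (Counting.count-ColoredTree C⁽ ℓ ℕ.* 2 ⁾ series series-zero series-suc n)
  where open Colors ℓ
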